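{- Let $\varepsilon > 0$. There exists a set $A \subseteq \mathbb{N}$ with $d^*_\times(A) > 1 - \varepsilon$ such that whenever $B \subseteq \mathbb{N}$, $t \in \mathbb{Q}_{>0}$ and $k \ge 2$ satisfy $$tB^{\odot k} = \Big\{ t \prod_{i=1}^k b_i : b_1, \dots, b_k \in B,\ b_1 < \dots < b_k \Big\} \subseteq A,$$ the set $B$ is finite.
   Context: $\mathbb{N} = \{1,2,3,\dots\}$. A Følner sequence in the multiplicative semigroup $(\mathbb{N}, \times)$ is a sequence $(\Phi_N)_{N\in\mathbb{N}}$ of finite subsets of $\mathbb{N}$ with $\lim_{N\to\infty} |x\Phi_N \triangle \Phi_N|/|\Phi_N| = 0$ for every $x \in \mathbb{N}$, where $x\Phi_N = \{xy : y \in \Phi_N\}$. The multiplicative upper Banach density of $A \subseteq \mathbb{N}$ is $d^*_\times(A) = \sup_\Phi \limsup_{N\to\infty} |A \cap \Phi_N|/|\Phi_N|$, the supremum over all Følner sequences $\Phi$ in $(\mathbb{N},\times)$. -}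

module Defs where

open import Level using (0ℓ)
open import Data.Nat as ℕ using (ℕ; zero; suc; _≤_; _<_)
open import Data.Nat.ListAction using (product)
open import Data.Integer using (+_)
open import Data.Rational as ℚ using (ℚ; _/_; 0ℚ; 1ℚ)
open import Data.Fin using (Fin)
import Data.Fin as Fin
open import Data.List using (List; length; filter; map)
import Data.List as List
open import Data.List.Relation.Unary.Unique.Propositional using (Unique)
open import Data.List.Relation.Unary.All using (All)
open import Data.List.Membership.Propositional using (_∈_)
open import Data.List.Membership.DecPropositional ℕ._≟_ using (_∉?_)
open import Data.Product using (Σ; ∃; _×_)
open import Relation.Unary using (Pred; Decidable)
open import Relation.Binary.PropositionalEquality using (_≡_)

-- Subsets of ℕ are predicates.  The paper's ℕ = {1,2,3,...}; we use Agda's ℕ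
-- and impose positivity explicitly where it matters.

ℕ→ℚ : ℕ → ℚ
ℕ→ℚ n = + n / 1

-- The ratio n / d as a rational (d = 0 gives 0; only used with d > 0).
frac : ℕ → ℕ → ℚ
frac n zero    = 0ℚ
frac n (suc d) = + n / suc d

IsFinSubset : List ℕ → Set
IsFinSubset Φ = Unique Φ × All (λ y → 1 ≤ y) Φ

_·_ : ℕ → List ℕ → List ℕ
x · Φ = map (x ℕ.*_) Φ

-- | X \ Y | for finite sets given as duplicate-free lists
diffCard : List ℕ → List ℕ → ℕ
diffCard X Y = length (filter (_∉? Y) X)

symDiffCard : ℕ → List ℕ → ℕ
symDiffCard x Φ = diffCard (x · Φ) Φ ℕ.+ diffCard Φ (x · Φ)

interCard : {A : Pred ℕ 0ℓ} → Decidable A → List ℕ → ℕ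
interCard A? Φ = length (filter A? Φ)

IsFolner : (ℕ → List ℕ) → Set
IsFolner Φ =
  (∀ N → IsFinSubset (Φ N)) ×
  (∀ N → 0 < length (Φ N)) ×
  (∀ x → 1 ≤ x → ∀ (η : ℚ) → 0ℚ ℚ.< η →
     ∃ λ M → ∀ N → M ≤ N → frac (symDiffCard x (Φ N)) (length (Φ N)) ℚ.< η)

LimsupRatioExceeds : {A : Pred ℕ 0ℓ} → Decidable A → (ℕ → List ℕ) → ℚ → Set
LimsupRatioExceeds A? Φ c =
  ∃ λ (r : ℚ) → c ℚ.< r ×
    (∀ M → ∃ λ N → M ≤ N × r ℚ.< frac (interCard A? (Φ N)) (length (Φ N)))

-- d*_×(A) > c  (unfolded: sup over Følner sequences of the limsup exceeds c)
BanachDensityExceeds : {A : Pred ℕ 0ℓ} → Decidable A → ℚ → Set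
BanachDensityExceeds A? c =
  ∃ λ (Φ : ℕ → List ℕ) → IsFolner Φ × LimsupRatioExceeds A? Φ c

ScaledProdSetSubset : ℚ → (B : Pred ℕ 0ℓ) → ℕ → (A : Pred ℕ 0ℓ) → Set
ScaledProdSetSubset t B k A =
  ∀ (b : Fin k → ℕ) →
    (∀ i j → i Fin.< j → b i < b j) →
    (∀ i → B (b i)) →
    ∃ λ n → (t ℚ.* ℕ→ℚ (product (List.tabulate b)) ≡ ℕ→ℚ n) × A n

Finite : Pred ℕ 0ℓ → Set
Finite B = Σ (List ℕ) λ xs → ∀ b → B b → b ∈ xs

{-# OPTIONS --safe #-}

-- Write t = a/b and let q₀, q₁, … be the primes.  If all valuations of the elements of a set at
-- q₀, …, q_{m-1} agree modulo k, then a product P of k of its elements has all these valuations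
-- divisible by k, and so has n b a^{k-1} = a^k P for n = tP.  By pigeonhole every infinite B has an
-- infinite subset of this kind, hence tB^{⊙k} meets every cofinite part of the class
--   { n : k divides ν_{q_i}(n w) for all i < m },   w = b a^{k-1},
-- which has density only k^{-m}.  Enumerate the pairs (w, k) and remove from ℕ, for the j-th pair,
-- the elements of its class with m = s + j + 1 that exceed all elements of Φ_0, …, Φ_{j-1}, where
-- Φ_N is the Følner set of all q₀^{e₀} ⋯ q_{d-1}^{e_{d-1}} with d = s + N + 1 and exponents below
-- a common multiple of the first N + 1 values of k.  Only the classes j ≤ N remove anything from
-- Φ_N, and together they remove at most a proportion 2^{-s}.
module Submission where

open import Defs
open import Level using (0ℓ)
import Algebra.Properties.CommutativeSemigroup as CommutativeSemigroupProperties
open import Data.Empty using (⊥; ⊥-elim)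
open import Data.Fin using (Fin; zero; suc)
import Data.Fin as Fin
open import Data.Integer using (+_)
import Data.Integer as ℤ
import Data.Integer.Properties as ℤ
open import Data.List using (List; []; _∷_; _++_; length; filter; map; applyUpTo; upTo; cartesianProductWith; tabulate)
open import Data.List.Membership.Propositional using (_∈_)
open import Data.List.Membership.Propositional.Properties
  using (∈-map⁺; ∈-++⁺ˡ; ∈-++⁺ʳ; ∈-upTo⁺; ∈-upTo⁻; ∈-cartesianProductWith⁺; ∈-cartesianProductWith⁻)
open import Data.List.Properties
  using (filter-++; filter-accept; filter-reject; filter-none; length-++; length-filter; length-map; length-applyUpTo; map-∘; map-id)
open import Data.List.Relation.Binary.Permutation.Propositional.Properties using (filter-↭; ↭-length)
open import Data.List.Relation.Unary.All as All using (All; []; _∷_)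
import Data.List.Relation.Unary.All.Properties as All
open import Data.List.Relation.Unary.AllPairs using ([]; _∷_)
open import Data.List.Relation.Unary.Any using (here; there)
open import Data.List.Relation.Unary.Unique.Propositional using (Unique)
import Data.List.Relation.Unary.Unique.Propositional.Properties as Unique
open import Data.Nat as ℕ
  using (ℕ; zero; suc; _+_; _*_; _∸_; _^_; _%_; _!; _≤_; _<_; _≟_; _≤?_; _<?_; z≤n; s≤s; s<s⁻¹; s≤s⁻¹; NonZero; ≢-nonZero⁻¹; >-nonZero)
open import Data.List.Membership.DecPropositional _≟_ using (_∉?_)
open import Data.Nat.Divisibility
  using (_∣_; _∣?_; divides; ∣-refl; ∣-trans; ∣1⇒≡1; >⇒∤; m∣m*n; n∣m*n; ∣n⇒∣m*n; ∣m∣n⇒∣m+n; ∣m+n∣m⇒∣n; m≤n⇒m!∣n!)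
open import Data.Nat.DivMod using (m≡m%n+[m/n]*n; m%n<n)
open import Data.Nat.Induction using (<-rec)
open import Data.Nat.ListAction using (product) renaming (sum to sumList)
open import Data.Nat.ListAction.Properties using (product-++; product≢0)
open import Data.Nat.Primality using (Prime; prime?; prime⇒nonZero; ¬prime[1])
open import Data.Nat.Primality.Factorisation using (PrimeFactorisation; factorise; factorisationUnique)
open import Data.Nat.Properties
open import Data.Product using (Σ; ∃; _×_; _,_; proj₁; proj₂)
open import Data.Rational using (ℚ; 0ℚ; 1ℚ; mkℚ; _/_)
import Data.Rational as ℚ
import Data.Rational.Properties as ℚ
open import Data.Rational.Unnormalised using (mkℚᵘ; *<*; *≡*)
import Data.Rational.Unnormalised as ℚᵘ
import Data.Rational.Unnormalised.Properties as ℚᵘ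
open import Data.Sum using (_⊎_; inj₁; inj₂)
open import Data.Vec using (Vec; []; _∷_; sum; zipWith)
open import Data.Vec.Properties using (∷-injective)
open import Data.Vec.Relation.Binary.Pointwise.Inductive as Pointwise using (Pointwise; []; _∷_)
open import Data.Vec.Relation.Unary.All as VAll using ([]; _∷_)
open import Function using (_∘_; id)
import Relation.Binary.Definitions as Binary
open import Relation.Binary.Definitions using (tri<; tri≈; tri>)
open import Relation.Binary.PropositionalEquality
open import Relation.Nullary using (¬_; ¬?; yes; no; contradiction; _×-dec_)
open import Relation.Unary using (Pred; Decidable; _⊆_)

open PrimeFactorisation

private
  module +-CS = CommutativeSemigroupProperties +-commutativeSemigroup
  module *-CS = CommutativeSemigroupProperties *-commutativeSemigroup

-- Valuations at primes

multiplicity : ℕ → List ℕ → ℕ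
multiplicity p xs = length (filter (p ≟_) xs)

abstract
  -- Junk value ν p 0 = 0.
  ν : ℕ → ℕ → ℕ
  ν p zero    = 0
  ν p (suc n) = multiplicity p (factors (factorise (suc n)))

  -- Unique factorisation: any list of primes with product `n` is a permutation of the chosen one,
  -- and counting occurrences is invariant under permutation.
  ν-product : ∀ p {n ps} → n ≡ product ps → All Prime ps → ν p n ≡ multiplicity p ps
  ν-product p {zero} {ps} eq prs = contradiction (sym eq) (≢-nonZero⁻¹ (product ps) {{product≢0 (All.map prime⇒nonZero prs)}})
  ν-product p {suc n} eq prs = ↭-length (filter-↭ (p ≟_) (factorisationUnique (factorise (suc n))
    (record { factors = _ ; isFactorisation = eq ; factorsPrime = prs })))

ν-* : ∀ p m n → 1 ≤ m → 1 ≤ n → ν p (m * n) ≡ ν p m + ν p n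
ν-* p m@(suc _) n@(suc _) _ _ = begin
  ν p (m * n)                                      ≡⟨ ν-product p mn≡product (All.++⁺ (factorsPrime F) (factorsPrime G)) ⟩
  multiplicity p (factors F ++ factors G)          ≡⟨ cong length (filter-++ (p ≟_) (factors F) (factors G)) ⟩
  length (filter (p ≟_) (factors F) ++ filter (p ≟_) (factors G))
                                                   ≡⟨ length-++ (filter (p ≟_) (factors F)) ⟩
  multiplicity p (factors F) + multiplicity p (factors G)
    ≡⟨ cong₂ _+_ (ν-product p (isFactorisation F) (factorsPrime F)) (ν-product p (isFactorisation G) (factorsPrime G)) ⟨
  ν p m + ν p n                                    ∎
  where
  open ≡-Reasoning
  F = factorise m
  G = factorise n
  mn≡product : m * n ≡ product (factors F ++ factors G)
  mn≡product = trans (cong₂ _*_ (isFactorisation F) (isFactorisation G)) (sym (product-++ (factors F) (factors G)))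

ν-1 : ∀ p → ν p 1 ≡ 0
ν-1 p = ν-product p {1} {[]} refl []

ν-self : ∀ {p} → Prime p → ν p p ≡ 1
ν-self {p} pr = trans (ν-product p (sym (*-identityʳ p)) (pr ∷ []))
  (cong length (filter-accept (p ≟_) {p} {[]} refl))

ν-other : ∀ {p q} → Prime q → p ≢ q → ν p q ≡ 0
ν-other {p} {q} pr p≢q = trans (ν-product p (sym (*-identityʳ q)) (pr ∷ []))
  (cong length (filter-reject (p ≟_) {q} {[]} p≢q))

1≤* : ∀ {m n} → 1 ≤ m → 1 ≤ n → 1 ≤ m * n
1≤* = *-mono-≤

1≤^ : ∀ {m} n → 1 ≤ m → 1 ≤ m ^ n
1≤^ zero    _   = ≤-refl
1≤^ (suc n) 1≤m = 1≤* 1≤m (1≤^ n 1≤m)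

ν-^ : ∀ p m n → 1 ≤ m → ν p (m ^ n) ≡ n * ν p m
ν-^ p m zero    _   = ν-1 p
ν-^ p m (suc n) 1≤m = trans (ν-* p m (m ^ n) 1≤m (1≤^ n 1≤m)) (cong (λ t → ν p m + t) (ν-^ p m n 1≤m))

prime⇒2≤ : ∀ {p} → Prime p → 2 ≤ p
prime⇒2≤ {zero} pr = contradiction (prime⇒nonZero pr) λ ()
prime⇒2≤ {1} pr = contradiction pr ¬prime[1]
prime⇒2≤ {suc (suc p)} pr = s≤s (s≤s z≤n)

prime⇒1≤ : ∀ {p} → Prime p → 1 ≤ p
prime⇒1≤ pr = ≤-trans (s≤s z≤n) (prime⇒2≤ pr)

-- Enumeration of all primes

least : {P : Pred ℕ 0ℓ} → Decidable P → ∀ n → P n → ∃ λ m → P m × (∀ i → i < m → ¬ P i)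
least {P} P? = <-rec (λ n → P n → ∃ λ m → P m × (∀ i → i < m → ¬ P i)) step
  where
  step : ∀ n → (∀ {m} → m < n → P m → ∃ λ m → P m × (∀ i → i < m → ¬ P i)) →
         P n → ∃ λ m → P m × (∀ i → i < m → ¬ P i)
  step n rec Pn with anyUpTo? P? n
  ... | yes (m , m<n , Pm) = rec m<n Pm
  ... | no none            = n , Pn , λ i i<n Pi → none (i , i<n , Pi)

IsPrimeAbove : ℕ → Pred ℕ 0ℓ
IsPrimeAbove n p = Prime p × n < p

isPrimeAbove? : ∀ n → Decidable (IsPrimeAbove n)
isPrimeAbove? n p = prime? p ×-dec (n <? p)

-- Euclid's argument: a prime factor `p ≤ n` of `n ! + 1` would divide `p !`, hence `n !`, hence 1.
∃-primeAbove : ∀ n → ∃ (IsPrimeAbove n)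
∃-primeAbove n with factorise (suc (n !))
... | record { factors = [] ; isFactorisation = eq } =
  contradiction (suc-injective eq) (λ n!≡0 → <⇒≢ (1≤n! n) (sym n!≡0))
... | record { factors = p ∷ ps ; isFactorisation = eq ; factorsPrime = pr ∷ _ } = p , pr , n<p
  where
  p∣1+n! : p ∣ n ! + 1
  p∣1+n! = subst (p ∣_) (trans (sym eq) (sym (+-comm (n !) 1))) (m∣m*n (product ps))
  p∣p! : ∀ {p} → Prime p → p ∣ p !
  p∣p! {zero} pr = contradiction (prime⇒2≤ pr) λ ()
  p∣p! {suc p} pr = m∣m*n (p !)
  n<p : n < p
  n<p with n <? p
  ... | yes lt = lt
  ... | no n≮p = contradiction
    (subst Prime (∣1⇒≡1 (∣m+n∣m⇒∣n p∣1+n! (∣-trans (p∣p! pr) (m≤n⇒m!∣n! (≮⇒≥ n≮p))))) pr) ¬prime[1]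

record DistinctPrimes (q : ℕ → ℕ) : Set where
  constructor distinctPrimes
  field
    prime     : ∀ i → Prime (q i)
    injective : ∀ {i j} → q i ≡ q j → i ≡ j

open DistinctPrimes

tailPrimes : ∀ {q} → DistinctPrimes q → DistinctPrimes (q ∘ suc)
tailPrimes Q .prime i      = Q .prime (suc i)
tailPrimes Q .injective eq = suc-injective (Q .injective eq)

abstract
  -- Each `p (suc i)` is the least prime above `p i`, so no prime is skipped. Since `i < p i`, a
  -- prime `q` lies below `p q`, and descending from there finds its index.
  primeEnumeration : ∃ λ q → DistinctPrimes q × (∀ {p} → Prime p → ∃ λ i → p ≡ q i)
  primeEnumeration = p , distinctPrimes p-prime p-injective , p-surjective
    where
    next : ∀ n → ∃ λ q → IsPrimeAbove n q × (∀ i → i < q → ¬ IsPrimeAbove n i)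
    next n = least (isPrimeAbove? n) _ (proj₂ (∃-primeAbove n))

    p : ℕ → ℕ
    p zero    = proj₁ (next 0)
    p (suc i) = proj₁ (next (p i))

    p-prime : ∀ i → Prime (p i)
    p-prime zero    = proj₁ (proj₁ (proj₂ (next 0)))
    p-prime (suc i) = proj₁ (proj₁ (proj₂ (next (p i))))

    p-suc : ∀ i → p i < p (suc i)
    p-suc i = proj₂ (proj₁ (proj₂ (next (p i))))

    p-mono : ∀ {i j} → i < j → p i < p j
    p-mono {i} {suc j} (s≤s i≤j) with m≤n⇒m<n∨m≡n i≤j
    ... | inj₁ i<j  = <-trans (p-mono i<j) (p-suc j)
    ... | inj₂ refl = p-suc i

    p-injective : ∀ {i j} → p i ≡ p j → i ≡ j
    p-injective {i} {j} eq with <-cmp i j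
    ... | tri< i<j _ _ = contradiction eq (<⇒≢ (p-mono i<j))
    ... | tri≈ _ i≡j _ = i≡j
    ... | tri> _ _ j<i = contradiction (sym eq) (<⇒≢ (p-mono j<i))

    i<p : ∀ i → i < p i
    i<p zero    = prime⇒1≤ (p-prime 0)
    i<p (suc i) = ≤-<-trans (i<p i) (p-suc i)

    gap : ∀ {q} → Prime q → ∀ n → q < p n → ∃ λ i → q ≡ p i
    gap {q} pr zero    q<p = ⊥-elim (proj₂ (proj₂ (next 0)) q q<p (pr , prime⇒1≤ pr))
    gap {q} pr (suc n) q<p with <-cmp q (p n)
    ... | tri< lt _ _ = gap pr n lt
    ... | tri≈ _ eq _ = n , eq
    ... | tri> _ _ gt = ⊥-elim (proj₂ (proj₂ (next (p n))) q q<p (pr , gt))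

    p-surjective : ∀ {q} → Prime q → ∃ λ i → q ≡ p i
    p-surjective {q} pr = gap pr q (i<p q)

-- Exponent vectors

eval : ∀ {d} → (ℕ → ℕ) → Vec ℕ d → ℕ
eval q []       = 1
eval q (e ∷ es) = q 0 ^ e * eval (q ∘ suc) es

-- Junk value 0 beyond the length, matching the valuation at unused primes.
coord : ∀ {d} → Vec ℕ d → ℕ → ℕ
coord []       i       = 0
coord (e ∷ es) zero    = e
coord (e ∷ es) (suc i) = coord es i

coord-injective : ∀ {d} (as bs : Vec ℕ d) → (∀ i → coord as i ≡ coord bs i) → as ≡ bs
coord-injective []       []       eq = refl
coord-injective (a ∷ as) (b ∷ bs) eq = cong₂ _∷_ (eq 0) (coord-injective as bs (eq ∘ suc))

1≤eval : ∀ {q d} → DistinctPrimes q → (es : Vec ℕ d) → 1 ≤ eval q es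
1≤eval Q []       = ≤-refl
1≤eval Q (e ∷ es) = 1≤* (1≤^ e (prime⇒1≤ (Q .prime 0))) (1≤eval (tailPrimes Q) es)

ν-eval-∷ : ∀ {q d} → DistinctPrimes q → ∀ p e (es : Vec ℕ d) →
           ν p (eval q (e ∷ es)) ≡ e * ν p (q 0) + ν p (eval (q ∘ suc) es)
ν-eval-∷ {q} Q p e es = trans
  (ν-* p _ _ (1≤^ e 1≤q) (1≤eval (tailPrimes Q) es))
  (cong (_+ ν p (eval (q ∘ suc) es)) (ν-^ p (q 0) e 1≤q))
  where 1≤q = prime⇒1≤ (Q .prime 0)

ν-eval-foreign : ∀ {q d} → DistinctPrimes q → ∀ {p} → (∀ i → p ≢ q i) → (es : Vec ℕ d) →
                 ν p (eval q es) ≡ 0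
ν-eval-foreign Q {p} foreign []       = ν-1 p
ν-eval-foreign Q {p} foreign (e ∷ es) = trans (ν-eval-∷ Q p e es)
  (cong₂ _+_ (trans (cong (e *_) (ν-other (Q .prime 0) (foreign 0))) (*-zeroʳ e))
             (ν-eval-foreign (tailPrimes Q) (foreign ∘ suc) es))

ν-eval : ∀ {q d} → DistinctPrimes q → (es : Vec ℕ d) → ∀ i → ν (q i) (eval q es) ≡ coord es i
ν-eval {q} Q []       i       = ν-1 (q i)
ν-eval {q} Q (e ∷ es) zero    = trans (ν-eval-∷ Q (q 0) e es) (trans
  (cong₂ _+_ (trans (cong (e *_) (ν-self (Q .prime 0))) (*-identityʳ e))
             (ν-eval-foreign (tailPrimes Q) (λ i eq → contradiction (Q .injective eq) λ ()) es))
  (+-identityʳ e))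
ν-eval {q} Q (e ∷ es) (suc i) = trans (ν-eval-∷ Q (q (suc i)) e es) (trans
  (cong (_+ ν (q (suc i)) (eval (q ∘ suc) es)) (trans
    (cong (e *_) (ν-other (Q .prime 0) (λ eq → contradiction (Q .injective eq) λ ())))
    (*-zeroʳ e)))
  (ν-eval (tailPrimes Q) es i))

-- The valuations at the `q i` read the exponents back.
eval-injective : ∀ {q d} → DistinctPrimes q → {as bs : Vec ℕ d} → eval q as ≡ eval q bs → as ≡ bs
eval-injective {q} Q {as} {bs} eq = coord-injective as bs λ i →
  trans (sym (ν-eval Q as i)) (trans (cong (ν (q i)) eq) (ν-eval Q bs i))

evalOfPrime : ∀ q {d i} → i < d → (es : Vec ℕ d) →
              ∃ λ (as : Vec ℕ d) → eval q as ≡ q i * eval q es × sum as ≡ suc (sum es)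
evalOfPrime q {i = zero}  _         (e ∷ es) = suc e ∷ es , *-assoc (q 0) (q 0 ^ e) _ , refl
evalOfPrime q {i = suc i} (s≤s i<d) (e ∷ es) with evalOfPrime (q ∘ suc) i<d es
... | as , eq , s = e ∷ as ,
  trans (cong (q 0 ^ e *_) eq) (*-CS.x∙yz≈y∙xz (q 0 ^ e) (q (suc i)) _) ,
  trans (cong (λ t → e + t) s) (+-suc e (sum es))

evalOfUnit : ∀ q d → ∃ λ (as : Vec ℕ d) → eval q as ≡ 1 × sum as ≡ 0
evalOfUnit q zero    = [] , refl , refl
evalOfUnit q (suc d) with evalOfUnit (q ∘ suc) d
... | as , eq , s = 0 ∷ as , trans (+-identityʳ _) eq , s

-- The sum `s` counts the prime factors of `x` with multiplicity and is chosen before `d`: the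
-- Følner estimate for `x` needs a bound that stays fixed while the dimension grows. Every prime
-- index occurring in `x` is below `d₀`.
exponentVector : ∀ q → (∀ {p} → Prime p → ∃ λ i → p ≡ q i) → ∀ x → 1 ≤ x →
  ∃ λ s → ∃ λ d₀ → ∀ d → d₀ ≤ d → ∃ λ (as : Vec ℕ d) → eval q as ≡ x × sum as ≡ s
exponentVector q surj x@(suc _) _ with factorise x
... | record { factors = ps ; isFactorisation = eq ; factorsPrime = prs } rewrite eq = go ps prs
  where
  go : ∀ ps → All Prime ps →
    ∃ λ s → ∃ λ d₀ → ∀ d → d₀ ≤ d → ∃ λ (as : Vec ℕ d) → eval q as ≡ product ps × sum as ≡ s
  go []       _          = 0 , 0 , λ d _ → evalOfUnit q d
  go (p ∷ ps) (pr ∷ prs) with go ps prs | surj pr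
  ... | s , d₀ , rep | i , refl = suc s , suc i + d₀ , λ d d≥ →
    let as , eq , ss = rep d (≤-trans (m≤n+m d₀ (suc i)) d≥)
        bs , eq′ , ss′ = evalOfPrime q (≤-trans (m≤m+n (suc i) d₀) d≥) as
    in bs , trans eq′ (cong (q i *_) eq) , trans ss′ (cong suc ss)

-- Counting in lists and products

module _ {A : Set} {P : Pred A 0ℓ} (P? : Decidable P) where

  count : List A → ℕ
  count xs = length (filter P? xs)

  count-++ : ∀ xs ys → count (xs ++ ys) ≡ count xs + count ys
  count-++ xs ys = trans (cong length (filter-++ P? xs ys)) (length-++ (filter P? xs))

count-map-mono : ∀ {A B : Set} {P : Pred B 0ℓ} {Q : Pred A 0ℓ} (P? : Decidable P) (Q? : Decidable Q) (f : A → B) xs →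
                 (∀ {x} → x ∈ xs → P (f x) → Q x) → count P? (map f xs) ≤ count Q? xs
count-map-mono P? Q? f []       P⇒Q = z≤n
count-map-mono P? Q? f (x ∷ xs) P⇒Q with P? (f x) | Q? x
... | yes _ | yes _ = s≤s (count-map-mono P? Q? f xs (P⇒Q ∘ there))
... | yes p | no ¬q = contradiction (P⇒Q (here refl) p) ¬q
... | no _  | yes _ = m≤n⇒m≤1+n (count-map-mono P? Q? f xs (P⇒Q ∘ there))
... | no _  | no _  = count-map-mono P? Q? f xs (P⇒Q ∘ there)

module _ {A B C : Set} {P : Pred C 0ℓ} {Q : Pred A 0ℓ} {R : Pred B 0ℓ}
         (P? : Decidable P) (Q? : Decidable Q) (R? : Decidable R) (f : A → B → C) where

  count-product-× : (∀ {x y} → P (f x y) → Q x × R y) → ∀ xs ys →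
                    count P? (cartesianProductWith f xs ys) ≤ count Q? xs * count R? ys
  count-product-× split []       ys = z≤n
  count-product-× split (x ∷ xs) ys = ≤-trans (≤-reflexive (count-++ P? (map (f x) ys) _)) row
    where
    ih = count-product-× split xs ys
    row : count P? (map (f x) ys) + count P? (cartesianProductWith f xs ys) ≤ count Q? (x ∷ xs) * count R? ys
    row with Q? x
    ... | yes _ = +-mono-≤ (count-map-mono P? R? (f x) ys (λ _ → proj₂ ∘ split)) ih
    ... | no ¬q = ≤-trans (+-monoˡ-≤ _ (≤-reflexive (cong length (filter-none P?
                    (All.map⁺ (All.universal (λ y p → ¬q (proj₁ (split p))) ys)))))) ih

  -- A row with `Q x` is charged in full; in every other row only `R` can be responsible.
  count-product-⊎ : (∀ {x y} → P (f x y) → Q x ⊎ R y) → ∀ xs ys →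
                    count P? (cartesianProductWith f xs ys) ≤ count Q? xs * length ys + length xs * count R? ys
  count-product-⊎ split []       ys = z≤n
  count-product-⊎ split (x ∷ xs) ys = ≤-trans (≤-reflexive (count-++ P? (map (f x) ys) _)) row
    where
    ih = count-product-⊎ split xs ys
    row : count P? (map (f x) ys) + count P? (cartesianProductWith f xs ys) ≤
          count Q? (x ∷ xs) * length ys + (count R? ys + length xs * count R? ys)
    row with Q? x
    ... | yes _ = begin
      count P? (map (f x) ys) + count P? (cartesianProductWith f xs ys)
        ≤⟨ +-mono-≤ (≤-trans (length-filter P? (map (f x) ys)) (≤-reflexive (length-map (f x) ys))) ih ⟩
      length ys + (count Q? xs * length ys + length xs * count R? ys)
        ≡⟨ +-assoc (length ys) (count Q? xs * length ys) _ ⟨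
      length ys + count Q? xs * length ys + length xs * count R? ys
        ≤⟨ +-monoʳ-≤ (length ys + count Q? xs * length ys) (m≤n+m _ (count R? ys)) ⟩
      length ys + count Q? xs * length ys + (count R? ys + length xs * count R? ys) ∎
      where open ≤-Reasoning
    ... | no ¬q = begin
      count P? (map (f x) ys) + count P? (cartesianProductWith f xs ys)
        ≤⟨ +-mono-≤ (count-map-mono P? R? (f x) ys (λ _ → only ∘ split)) ih ⟩
      count R? ys + (count Q? xs * length ys + length xs * count R? ys)
        ≡⟨ +-CS.x∙yz≈y∙xz (count R? ys) (count Q? xs * length ys) _ ⟩
      count Q? xs * length ys + (count R? ys + length xs * count R? ys) ∎
      where
      open ≤-Reasoning
      only : ∀ {y} → Q x ⊎ R y → R y
      only (inj₁ q) = contradiction q ¬q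
      only (inj₂ r) = r

-- Counting in intervals and residue classes

applyUpTo-+ : ∀ {A : Set} (f : ℕ → A) m n → applyUpTo f (m + n) ≡ applyUpTo f m ++ applyUpTo (λ e → f (m + e)) n
applyUpTo-+ f zero    n = refl
applyUpTo-+ f (suc m) n = cong (f 0 ∷_) (applyUpTo-+ (f ∘ suc) m n)

module _ {P : Pred ℕ 0ℓ} (P? : Decidable P) where

  -- The property is tested at `f e` but bounded through the index `e`, which lets the recursion
  -- pass to `f ∘ suc`; the same device serves the next three lemmas.
  count-below : ∀ f n a → (∀ e → P (f e) → e < a) → count P? (applyUpTo f n) ≤ a
  count-below f zero    a       bound = z≤n
  count-below f (suc n) zero    bound with P? (f 0)
  ... | yes p = contradiction (bound 0 p) λ ()
  ... | no _  = count-below (f ∘ suc) n 0 (λ e p → contradiction (bound (suc e) p) λ ())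
  count-below f (suc n) (suc a) bound with P? (f 0)
  ... | yes _ = s≤s (count-below (f ∘ suc) n a (λ e p → s<s⁻¹ (bound (suc e) p)))
  ... | no _  = m≤n⇒m≤1+n (count-below (f ∘ suc) n a (λ e p → s<s⁻¹ (bound (suc e) p)))

  count-above : ∀ f n a → (∀ e → P (f e) → n ≤ a + e) → count P? (applyUpTo f n) ≤ a
  count-above f zero    a bound = z≤n
  count-above f (suc n) a bound with P? (f 0)
  -- From the first hit onwards every entry may count, but the hypothesis at index 0 says that at
  -- most `a` entries are left.
  ... | yes p = ≤-trans (s≤s (≤-trans (length-filter P? (applyUpTo (f ∘ suc) n)) (≤-reflexive (length-applyUpTo (f ∘ suc) n))))
                        (subst (suc n ≤_) (+-identityʳ a) (bound 0 p))
  ... | no _  = count-above (f ∘ suc) n a (λ e p → s≤s⁻¹ (subst (suc n ≤_) (+-suc a e) (bound (suc e) p)))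

  -- Two hits in a block of length at most `k` would have indices whose difference is positive, less
  -- than `k` and divisible by `k`. The offset `c` absorbs the shift of the index in the recursion.
  count-residue-block : ∀ {k} f n c → n ≤ k → (∀ e → P (f e) → k ∣ e + c) → count P? (applyUpTo f n) ≤ 1
  count-residue-block f zero    c n≤k res = z≤n
  count-residue-block {k} f (suc n) c n≤k res with P? (f 0)
  ... | yes p = s≤s (≤-reflexive (cong length (filter-none P? (All.applyUpTo⁺₁ (f ∘ suc) n λ {e} e<n p′ →
                  >⇒∤ (<-≤-trans (s≤s e<n) n≤k) (∣m+n∣m⇒∣n (subst (k ∣_) (+-comm (suc e) c) (res (suc e) p′)) (res 0 p))))))
  ... | no _  = count-residue-block (f ∘ suc) n (suc c) (<⇒≤ n≤k)
                  (λ e p → subst (k ∣_) (sym (+-suc e c)) (res (suc e) p))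

  count-residue : ∀ {k} f q c → (∀ e → P (f e) → k ∣ e + c) → count P? (applyUpTo f (q * k)) ≤ q
  count-residue f zero    c res = z≤n
  count-residue {k} f (suc q) c res = begin
    count P? (applyUpTo f (k + q * k))
      ≡⟨ trans (cong (count P?) (applyUpTo-+ f k (q * k))) (count-++ P? (applyUpTo f k) _) ⟩
    count P? (applyUpTo f k) + count P? (applyUpTo (λ e → f (k + e)) (q * k))
      -- The first block contains at most one hit. Passing to the next block adds `k` to the index,
      -- which does not affect divisibility by `k`, so `c` stays the same.
      ≤⟨ +-mono-≤ (count-residue-block f k c ≤-refl res) (count-residue (λ e → f (k + e)) q c
           (λ e p → ∣m+n∣m⇒∣n (subst (k ∣_) (+-assoc k e c) (res (k + e) p)) ∣-refl)) ⟩
    suc q ∎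
    where open ≤-Reasoning

-- Boxes of exponent vectors

box : ℕ → ∀ d → List (Vec ℕ d)
box L zero    = [] ∷ []
box L (suc d) = cartesianProductWith _∷_ (upTo L) (box L d)

length-cartesianProductWith : ∀ {A B C : Set} (f : A → B → C) xs ys →
  length (cartesianProductWith f xs ys) ≡ length xs * length ys
length-cartesianProductWith f []       ys = refl
length-cartesianProductWith f (x ∷ xs) ys = trans (length-++ (map (f x) ys))
  (cong₂ _+_ (length-map (f x) ys) (length-cartesianProductWith f xs ys))

length-box : ∀ L d → length (box L d) ≡ L ^ d
length-box L zero    = refl
length-box L (suc d) = trans (length-cartesianProductWith _∷_ (upTo L) (box L d))
  (cong₂ _*_ (length-applyUpTo id L) (length-box L d))

box-unique : ∀ L d → Unique (box L d)
box-unique L zero    = [] ∷ []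
box-unique L (suc d) = Unique.cartesianProductWith⁺ _∷_ ∷-injective (Unique.upTo⁺ L) (box-unique L d)

∈-box⁺ : ∀ {L d} {es : Vec ℕ d} → VAll.All (_< L) es → es ∈ box L d
∈-box⁺ []            = here refl
∈-box⁺ (e<L ∷ es<L) = ∈-cartesianProductWith⁺ _∷_ (∈-upTo⁺ e<L) (∈-box⁺ es<L)

∈-box⁻ : ∀ {L d} {es : Vec ℕ d} → es ∈ box L d → VAll.All (_< L) es
∈-box⁻ {d = zero}  {[]} _ = []
∈-box⁻ {L} {suc d} es∈ with ∈-cartesianProductWith⁻ _∷_ (upTo L) (box L d) es∈
... | e , es , e∈ , es∈′ , refl = ∈-upTo⁻ e∈ ∷ ∈-box⁻ es∈′

-- Union bound over the coordinates: a violating vector violates `G` in some coordinate, and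
-- coordinate `a` does so for a proportion at most `a / L`. Denominators are multiplied out. The
-- relation is kept general to cover both halves of the symmetric difference.
count-violations : ∀ {G : ℕ → ℕ → Set} (G? : Binary.Decidable G) L →
  (∀ a → count (λ e → ¬? (G? a e)) (upTo L) ≤ a) →
  ∀ {d} (as : Vec ℕ d) → L * count (λ es → ¬? (Pointwise.decidable G? as es)) (box L d) ≤ sum as * L ^ d
count-violations G? L bound [] = ≤-reflexive (*-zeroʳ L)
count-violations {G} G? L bound {suc d} (a ∷ as) = begin
  L * count ∷Bad? (box L (suc d))
    ≤⟨ *-monoʳ-≤ L (count-product-⊎ ∷Bad? (λ e → ¬? (G? a e)) Bad? _∷_ split (upTo L) (box L d)) ⟩
  L * (count (λ e → ¬? (G? a e)) (upTo L) * length (box L d) + length (upTo L) * count Bad? (box L d))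
    ≤⟨ *-monoʳ-≤ L (+-mono-≤ (*-mono-≤ (bound a) (≤-reflexive (length-box L d)))
                             (≤-reflexive (cong (_* count Bad? (box L d)) (length-applyUpTo id L)))) ⟩
  L * (a * L ^ d + L * count Bad? (box L d))
    ≤⟨ *-monoʳ-≤ L (+-monoʳ-≤ (a * L ^ d) (count-violations G? L bound as)) ⟩
  L * (a * L ^ d + sum as * L ^ d)
    ≡⟨ cong (L *_) (*-distribʳ-+ (L ^ d) a (sum as)) ⟨
  L * ((a + sum as) * L ^ d)
    ≡⟨ *-CS.x∙yz≈y∙xz L (a + sum as) (L ^ d) ⟩
  (a + sum as) * L ^ suc d ∎
  where
  open ≤-Reasoning
  Bad? : Decidable (λ es → ¬ Pointwise G as es)
  Bad? es = ¬? (Pointwise.decidable G? as es)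
  ∷Bad? : Decidable (λ es → ¬ Pointwise G (a ∷ as) es)
  ∷Bad? es = ¬? (Pointwise.decidable G? (a ∷ as) es)
  split : ∀ {e es} → ¬ Pointwise G (a ∷ as) (e ∷ es) → ¬ G a e ⊎ ¬ Pointwise G as es
  split {e} {es} ¬g with G? a e
  ... | yes g = inj₂ (λ gs → ¬g (g ∷ gs))
  ... | no ¬h = inj₁ ¬h

DividesFirst : ℕ → (ℕ → ℕ) → ℕ → Set
DividesFirst k f m = ∀ {i} → i < m → k ∣ f i

dividesFirst? : ∀ k f → Decidable (DividesFirst k f)
dividesFirst? k f m = allUpTo? (λ i → k ∣? f i) m

-- The conditions on the first `m` coordinates are independent. Each one admits at most `q` of the
-- `q * k` exponents, a proportion `1 / k`, and the other coordinates are free.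
count-dividesFirst : ∀ k q {d} m (c : ℕ → ℕ) → m ≤ d →
  k ^ m * count (λ es → dividesFirst? k (λ i → coord es i + c i) m) (box (q * k) d) ≤ (q * k) ^ d
count-dividesFirst k q {d} zero c _ = ≤-trans (≤-reflexive (*-identityˡ _))
  (≤-trans (length-filter _ (box (q * k) d)) (≤-reflexive (length-box (q * k) d)))
count-dividesFirst k q {suc d} (suc m) c (s≤s m≤d) = begin
  k ^ suc m * count Div? (box L (suc d))
    ≤⟨ *-monoʳ-≤ (k ^ suc m) (count-product-× Div? (λ e → k ∣? e + c 0) Div′? _∷_
         (λ div → div (s≤s z≤n) , λ i<m → div (s≤s i<m)) (upTo L) (box L d)) ⟩
  k ^ suc m * (count (λ e → k ∣? e + c 0) (upTo L) * count Div′? (box L d))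
    ≤⟨ *-monoʳ-≤ (k ^ suc m) (*-monoˡ-≤ _ (count-residue (λ e → k ∣? e + c 0) id q (c 0) (λ _ → id))) ⟩
  k * k ^ m * (q * count Div′? (box L d))
    ≡⟨ *-CS.interchange k (k ^ m) q _ ⟩
  k * q * (k ^ m * count Div′? (box L d))
    ≤⟨ *-mono-≤ (≤-reflexive (*-comm k q)) (count-dividesFirst k q m (c ∘ suc) m≤d) ⟩
  L ^ suc d ∎
  where
  open ≤-Reasoning
  L = q * k
  Div? : Decidable {A = Vec ℕ (suc d)} (λ es → DividesFirst k (λ i → coord es i + c i) (suc m))
  Div? es = dividesFirst? k (λ i → coord es i + c i) (suc m)
  Div′? : Decidable {A = Vec ℕ d} (λ es → DividesFirst k (λ i → coord es i + c (suc i)) m)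
  Div′? es = dividesFirst? k (λ i → coord es i + c (suc i)) m

-- Translation of exponent vectors

eval-zipWith-+ : ∀ q {d} (as bs : Vec ℕ d) → eval q (zipWith _+_ as bs) ≡ eval q as * eval q bs
eval-zipWith-+ q []       []       = refl
eval-zipWith-+ q (a ∷ as) (b ∷ bs) = trans
  (cong₂ _*_ (^-distribˡ-+-* (q 0) a b) (eval-zipWith-+ (q ∘ suc) as bs))
  (*-CS.interchange (q 0 ^ a) (q 0 ^ b) _ _)

zipWith-+<L : ∀ {L d} {as es : Vec ℕ d} → Pointwise (λ a e → a + e < L) as es →
              VAll.All (_< L) (zipWith _+_ as es)
zipWith-+<L []       = []
zipWith-+<L (x ∷ xs) = x ∷ zipWith-+<L xs

zipWith-∸<L : ∀ {L d} {es : Vec ℕ d} (as : Vec ℕ d) → VAll.All (_< L) es →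
              VAll.All (_< L) (zipWith _∸_ es as)
zipWith-∸<L []       []       = []
zipWith-∸<L (a ∷ as) (x ∷ xs) = ≤-<-trans (m∸n≤m _ a) x ∷ zipWith-∸<L as xs

zipWith-+-∸ : ∀ {d} {as es : Vec ℕ d} → Pointwise _≤_ as es → zipWith _+_ as (zipWith _∸_ es as) ≡ es
zipWith-+-∸ []       = refl
zipWith-+-∸ (x ∷ xs) = cong₂ _∷_ (m+[n∸m]≡n x) (zipWith-+-∸ xs)

-- Union bounds and a geometric series

count-mono : ∀ {A : Set} {P Q : Pred A 0ℓ} (P? : Decidable P) (Q? : Decidable Q) xs →
             (∀ {x} → x ∈ xs → P x → Q x) → count P? xs ≤ count Q? xs
count-mono P? Q? xs P⇒Q = subst (λ ys → count P? ys ≤ count Q? xs) (map-id xs) (count-map-mono P? Q? id xs P⇒Q)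

count-⊎ : ∀ {A : Set} {P Q R : Pred A 0ℓ} (P? : Decidable P) (Q? : Decidable Q) (R? : Decidable R) xs →
          (∀ {x} → P x → Q x ⊎ R x) → count P? xs ≤ count Q? xs + count R? xs
count-⊎ P? Q? R? []       split = z≤n
count-⊎ P? Q? R? (x ∷ xs) split with count-⊎ P? Q? R? xs split | P? x | Q? x | R? x
... | ih | no _  | no _  | no _  = ih
... | ih | no _  | no _  | yes _ = ≤-trans ih (+-monoʳ-≤ (count Q? xs) (n≤1+n _))
... | ih | no _  | yes _ | no _  = m≤n⇒m≤1+n ih
... | ih | no _  | yes _ | yes _ = m≤n⇒m≤1+n (≤-trans ih (+-monoʳ-≤ (count Q? xs) (n≤1+n _)))
... | ih | yes p | yes _ | no _  = s≤s ih
... | ih | yes p | yes _ | yes _ = s≤s (≤-trans ih (+-monoʳ-≤ (count Q? xs) (n≤1+n _)))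
... | ih | yes p | no _  | yes _ = ≤-trans (s≤s ih) (≤-reflexive (sym (+-suc (count Q? xs) _)))
... | ih | yes p | no ¬q | no ¬r with split p
...   | inj₁ q = contradiction q ¬q
...   | inj₂ r = contradiction r ¬r

count-∃< : ∀ {A : Set} {R : ℕ → Pred A 0ℓ} (R? : ∀ j → Decidable (R j)) n xs →
           count (λ x → anyUpTo? (λ j → R? j x) n) xs ≤ sumList (applyUpTo (λ j → count (R? j) xs) n)
count-∃< R? zero    xs = none xs
  where
  none : ∀ xs → count (λ x → anyUpTo? (λ j → R? j x) 0) xs ≤ 0
  none []       = z≤n
  none (_ ∷ xs) = none xs
count-∃< {R = R} R? (suc n) xs = ≤-trans
  (count-⊎ (λ x → anyUpTo? (λ j → R? j x) (suc n)) (R? 0) (λ x → anyUpTo? (λ j → R? (suc j) x) n) xs split)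
  (+-monoʳ-≤ (count (R? 0) xs) (count-∃< (R? ∘ suc) n xs))
  where
  split : ∀ {x} → (∃ λ j → j < suc n × R j x) → R 0 x ⊎ (∃ λ j → j < n × R (suc j) x)
  split (zero  , _       , r) = inj₁ r
  split (suc j , s≤s j<n , r) = inj₂ (j , j<n , r)

count-complement : ∀ {A : Set} {P : Pred A 0ℓ} (P? : Decidable P) xs →
                   count P? xs + count (λ x → ¬? (P? x)) xs ≡ length xs
count-complement P? []       = refl
count-complement P? (x ∷ xs) with P? x
... | yes _ = cong suc (count-complement P? xs)
... | no _  = trans (+-suc _ _) (cong suc (count-complement P? xs))

sum-scale : ∀ a (c : ℕ → ℕ) n → sumList (applyUpTo (λ j → a * c j) n) ≡ a * sumList (applyUpTo c n)
sum-scale a c zero    = sym (*-zeroʳ a)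
sum-scale a c (suc n) = trans (cong (λ t → _ + t) (sum-scale a (c ∘ suc) n)) (sym (*-distribˡ-+ a (c 0) _))

-- After doubling, the first term is at most `T`, and the doubled tail satisfies the same hypothesis
-- with its index lowered by one, so it is at most `T` as well.
geometric-sum : ∀ {T} n (c : ℕ → ℕ) → (∀ {j} → j < n → 2 ^ suc j * c j ≤ T) → sumList (applyUpTo c n) ≤ T
geometric-sum zero        c bound = z≤n
geometric-sum {T} (suc n) c bound = *-cancelˡ-≤ 2 (begin
  2 * (c 0 + sumList (applyUpTo (c ∘ suc) n))
    ≡⟨ *-distribˡ-+ 2 (c 0) _ ⟩
  2 * c 0 + 2 * sumList (applyUpTo (c ∘ suc) n)
    ≡⟨ cong (λ t → _ + t) (sum-scale 2 (c ∘ suc) n) ⟨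
  2 * c 0 + sumList (applyUpTo (λ j → 2 * c (suc j)) n)
    ≤⟨ +-mono-≤ (bound (s≤s z≤n)) (geometric-sum n _ λ {j} j<n →
         ≤-trans (≤-reflexive (trans (sym (*-assoc (2 ^ suc j) 2 _)) (cong (_* c (suc j)) (*-comm (2 ^ suc j) 2))))
                 (bound (s≤s j<n))) ⟩
  T + T
    ≡⟨ cong (λ t → T + t) (+-identityʳ T) ⟨
  2 * T ∎)
  where open ≤-Reasoning

-- Rational inequalities in terms of natural numbers

fraction-< : ∀ a b c d → a * suc d < b * suc c → + a / suc c ℚ.< + b / suc d
fraction-< a b c d lt = ℚ.toℚᵘ-cancel-< (ℚᵘ.<-respˡ-≃ (ℚᵘ.≃-sym (ℚ.toℚᵘ-fromℚᵘ (mkℚᵘ (+ a) c)))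
  (ℚᵘ.<-respʳ-≃ (ℚᵘ.≃-sym (ℚ.toℚᵘ-fromℚᵘ (mkℚᵘ (+ b) d)))
    (*<* (subst₂ ℤ._<_ (ℤ.pos-* a (suc d)) (ℤ.pos-* b (suc c)) (ℤ.+<+ lt)))))

positiveFraction : ∀ {η} → 0ℚ ℚ.< η → ∃ λ a → ∃ λ b → + suc a / suc b ≡ η
positiveFraction {η@(mkℚ (+ suc a) b _)} _ = a , b , ℚ.↥p/↧p≡p η
positiveFraction {η@(mkℚ (+ zero) b _)} (ℚ.*<* lt) = contradiction (subst (ℤ._<_ (+ 0)) (ℤ.*-zeroˡ (+ 1)) lt) (ℤ.<-irrefl refl)
positiveFraction {η@(mkℚ (ℤ.-[1+ a ]) b _)} (ℚ.*<* ())

-- The bound is compared with `1 / suc b`, which is at most `suc a / suc b`.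
frac-<-positive : ∀ {a b n T} → suc b * n < T → frac n T ℚ.< + suc a / suc b
frac-<-positive {a} {b} {n} {suc T} lt = fraction-< n (suc a) T b
  (<-≤-trans (subst (_< suc T) (*-comm (suc b) n) lt) (m≤m+n (suc T) (a * suc T)))

-- Here `suc a / suc b` exceeds `1 / (b + 2)`, whose complement is the right-hand side. The gap
-- leaves room for the strict inequality in `LimsupRatioExceeds`.
one-minus-< : ∀ a b → 1ℚ ℚ.- + suc a / suc b ℚ.< + suc b / suc (suc b)
one-minus-< a b = subst (1ℚ ℚ.- + suc a / suc b ℚ.<_) 1-x≡r (ℚ.+-monoʳ-< 1ℚ (ℚ.neg-antimono-< x<ε))
  where
  r x : ℚ
  r = + suc b / suc (suc b)
  x = + 1 / suc (suc b)
  x<ε : x ℚ.< + suc a / suc b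
  x<ε = fraction-< 1 (suc a) (suc b) b (<-≤-trans (s≤s (≤-reflexive (*-identityˡ (suc b)))) (m≤m+n _ (a * suc (suc b))))
  r+x≡1 : r ℚ.+ x ≡ 1ℚ
  r+x≡1 = ℚ.toℚᵘ-injective (ℚᵘ.≃-trans (ℚ.toℚᵘ-homo-+ r x) (ℚᵘ.≃-trans
    (ℚᵘ.+-cong (ℚ.toℚᵘ-fromℚᵘ (mkℚᵘ (+ suc b) (suc b))) (ℚ.toℚᵘ-fromℚᵘ (mkℚᵘ (+ 1) (suc b))))
    (*≡* (cong +_ eq))))
    where
    D = suc (suc b)
    eq : (suc b * D + 1 * D) * 1 ≡ 1 * (D * D)
    eq = trans (*-identityʳ _) (trans (sym (*-distribʳ-+ D (suc b) 1))
           (trans (cong (_* D) (+-comm (suc b) 1)) (sym (*-identityˡ (D * D)))))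
  1-x≡r : 1ℚ ℚ.- x ≡ r
  1-x≡r = trans (cong (ℚ._- x) (sym r+x≡1)) (trans (ℚ.+-assoc r x (ℚ.- x))
            (trans (cong (r ℚ.+_) (ℚ.+-inverseʳ x)) (ℚ.+-identityʳ r)))

n<2^n : ∀ n → n < 2 ^ n
n<2^n zero    = s≤s z≤n
n<2^n (suc n) = begin
  suc (suc n)     ≤⟨ +-mono-≤ {1} (≤-trans (s≤s z≤n) (n<2^n n)) (n<2^n n) ⟩
  2 ^ n + 2 ^ n   ≡⟨ cong (λ t → 2 ^ n + t) (+-identityʳ (2 ^ n)) ⟨
  2 ^ suc n       ∎
  where open ≤-Reasoning

density-from-bad : ∀ b {good bad T} → good + bad ≡ T → suc (suc b) * bad < T →
                   + suc b / suc (suc b) ℚ.< frac good T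
density-from-bad b {good} {bad} {suc T} sum≡ lt = fraction-< (suc b) good (suc b) T
  -- One further copy of the total is added to both sides, which avoids subtracting `bad`.
  (+-cancelˡ-< (suc T) (suc b * suc T) (good * D) (begin-strict
    D * suc T            ≡⟨ cong (D *_) sum≡ ⟨
    D * (good + bad)     ≡⟨ *-distribˡ-+ D good bad ⟩
    D * good + D * bad   <⟨ +-monoʳ-< (D * good) lt ⟩
    D * good + suc T     ≡⟨ cong (_+ suc T) (*-comm D good) ⟩
    good * D + suc T     ≡⟨ +-comm (good * D) (suc T) ⟩
    suc T + good * D     ∎))
  where
  open ≤-Reasoning
  D = suc (suc b)

-- Grids as Følner sets

module _ {q : ℕ → ℕ} (Q : DistinctPrimes q) where

  grid : ℕ → ℕ → List ℕ
  grid L d = map (eval q) (box L d)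

  length-grid : ∀ L d → length (grid L d) ≡ L ^ d
  length-grid L d = trans (length-map (eval q) (box L d)) (length-box L d)

  grid-isFinSubset : ∀ L d → IsFinSubset (grid L d)
  grid-isFinSubset L d = Unique.map⁺ (eval-injective Q) (box-unique L d) ,
                         All.map⁺ (All.universal (1≤eval Q) (box L d))

  -- Multiplication by `eval q as` translates exponents by `as`, so a product can leave the grid
  -- only if some coordinate has `a + e ≥ L`.
  dilate-leaves : ∀ L {d} (as : Vec ℕ d) →
    L * diffCard (eval q as · grid L d) (grid L d) ≤ sum as * L ^ d
  dilate-leaves L {d} as = ≤-trans (*-monoʳ-≤ L (begin
    count (_∉? grid L d) (eval q as · grid L d)
      ≡⟨ cong (count (_∉? grid L d)) (map-∘ (box L d)) ⟨
    count (_∉? grid L d) (map (λ es → eval q as * eval q es) (box L d))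
      ≤⟨ count-map-mono (_∉? grid L d) Bad? _ (box L d) (λ {es} _ ∉grid pw →
           ∉grid (subst (_∈ grid L d) (eval-zipWith-+ q as es) (∈-map⁺ (eval q) (∈-box⁺ (zipWith-+<L pw))))) ⟩
    count Bad? (box L d) ∎))
    (count-violations (λ a e → a + e <? L) L
      (λ a → count-above (λ e → ¬? (a + e <? L)) id L a (λ e → ≮⇒≥)) as)
    where
    open ≤-Reasoning
    Bad? : Decidable (λ es → ¬ Pointwise (λ a e → a + e < L) as es)
    Bad? es = ¬? (Pointwise.decidable (λ a e → a + e <? L) as es)

  -- If `as ≤ es` coordinatewise, then `es` is the translate of `es ∸ as`, which is again in the
  -- box; a missed point therefore has a coordinate with `e < a`.
  dilate-misses : ∀ L {d} (as : Vec ℕ d) →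
    L * diffCard (grid L d) (eval q as · grid L d) ≤ sum as * L ^ d
  dilate-misses L {d} as = ≤-trans
    (*-monoʳ-≤ L (count-map-mono (_∉? (eval q as · grid L d)) Bad? (eval q) (box L d) (λ {es} es∈ ∉dil pw →
      ∉dil (subst (_∈ (eval q as · grid L d))
        (trans (sym (eval-zipWith-+ q as (zipWith _∸_ es as))) (cong (eval q) (zipWith-+-∸ pw)))
        (∈-map⁺ (eval q as *_) (∈-map⁺ (eval q) (∈-box⁺ (zipWith-∸<L as (∈-box⁻ es∈)))))))))
    (count-violations _≤?_ L (λ a → count-below (λ e → ¬? (a ≤? e)) id L a (λ e → ≰⇒>)) as)
    where
    Bad? : Decidable (λ es → ¬ Pointwise _≤_ as es)
    Bad? es = ¬? (Pointwise.decidable _≤?_ as es)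

  grid-almostInvariant : ∀ L {d} (as : Vec ℕ d) →
    L * symDiffCard (eval q as) (grid L d) ≤ (sum as + sum as) * L ^ d
  grid-almostInvariant L {d} as = begin
    L * symDiffCard (eval q as) (grid L d)   ≡⟨ *-distribˡ-+ L _ _ ⟩
    _                                        ≤⟨ +-mono-≤ (dilate-leaves L as) (dilate-misses L as) ⟩
    sum as * L ^ d + sum as * L ^ d          ≡⟨ *-distribʳ-+ (L ^ d) (sum as) (sum as) ⟨
    (sum as + sum as) * L ^ d                ∎
    where open ≤-Reasoning

  1≤length-grid : ∀ {L} d → 1 ≤ L → 1 ≤ length (grid L d)
  1≤length-grid {L} d 1≤L = subst (1 ≤_) (sym (length-grid L d)) (1≤^ d 1≤L)

  grid-isFolner : (∀ {p} → Prime p → ∃ λ i → p ≡ q i) → (L d : ℕ → ℕ) →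
    (∀ N → N < L N) → (∀ N → N ≤ d N) → IsFolner (λ N → grid (L N) (d N))
  grid-isFolner surj L d N<L N≤d =
    (λ N → grid-isFinSubset (L N) (d N)) ,
    (λ N → 1≤length-grid (d N) (1≤L N)) ,
    almostInvariant
    where
    1≤L : ∀ N → 1 ≤ L N
    1≤L N = ≤-trans (s≤s z≤n) (N<L N)
    almostInvariant : ∀ x → 1 ≤ x → ∀ η → 0ℚ ℚ.< η →
      ∃ λ M → ∀ N → M ≤ N → frac (symDiffCard x (grid (L N) (d N))) (length (grid (L N) (d N))) ℚ.< η
    almostInvariant x 1≤x η 0<η with positiveFraction 0<η | exponentVector q surj x 1≤x
    -- From `d₀` on, `x` is a product of the first `d N` primes. The second summand forces
    -- `suc b * (s + s) < L N`, which brings the proportion `2s / L N` below `1 / suc b`.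
    ... | a , b , refl | s , d₀ , represent = d₀ + suc b * (s + s) , small
      where
      small : ∀ N → d₀ + suc b * (s + s) ≤ N →
        frac (symDiffCard x (grid (L N) (d N))) (length (grid (L N) (d N))) ℚ.< + suc a / suc b
      small N M≤N with represent (d N) (≤-trans (m≤m+n d₀ _) (≤-trans M≤N (N≤d N)))
      ... | as , refl , refl = frac-<-positive {a} (*-cancelˡ-< (L N) _ _ (begin-strict
        L N * (suc b * symDiffCard x (grid (L N) (d N)))
          ≡⟨ *-CS.x∙yz≈y∙xz (L N) (suc b) _ ⟩
        suc b * (L N * symDiffCard x (grid (L N) (d N)))
          ≤⟨ *-monoʳ-≤ (suc b) (grid-almostInvariant (L N) as) ⟩
        suc b * ((s + s) * L N ^ d N)
          ≡⟨ *-assoc (suc b) (s + s) _ ⟨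
        suc b * (s + s) * L N ^ d N
          ≡⟨ cong (suc b * (s + s) *_) (length-grid (L N) (d N)) ⟨
        suc b * (s + s) * length (grid (L N) (d N))
          <⟨ *-monoˡ-< (length (grid (L N) (d N))) {{>-nonZero (1≤length-grid (d N) (1≤L N))}}
               (≤-<-trans (≤-trans (m≤n+m _ d₀) M≤N) (N<L N)) ⟩
        L N * length (grid (L N) (d N)) ∎))
        where
        open ≤-Reasoning

-- Pigeonhole for infinite sets

finite-⊎ : ∀ {P Q R : Pred ℕ 0ℓ} → Finite P → Finite Q → (∀ {b} → R b → P b ⊎ Q b) → Finite R
finite-⊎ {P} {Q} {R} (xs , P⊆) (ys , Q⊆) split = xs ++ ys , λ b Rb → [P,Q]⊆ b (split Rb)
  where
  [P,Q]⊆ : ∀ b → P b ⊎ Q b → b ∈ xs ++ ys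
  [P,Q]⊆ b (inj₁ p) = ∈-++⁺ˡ (P⊆ b p)
  [P,Q]⊆ b (inj₂ q) = ∈-++⁺ʳ xs (Q⊆ b q)

-- If no fibre is infinite, the sets where `f b < n` are finite by induction on `n`, and `n = K`
-- gives all of `B`. Since `B` is an arbitrary predicate, the fibre is obtained only under a double
-- negation.
infinite-fibre : ∀ {B : Pred ℕ 0ℓ} (f : ℕ → ℕ) K → (∀ b → f b < K) → ¬ Finite B →
                 ¬ ¬ ∃ λ r → ¬ Finite (λ b → B b × f b ≡ r)
infinite-fibre {B} f K f<K ¬fin noFibre = below K (λ (xs , ⊆xs) → ¬fin (xs , λ b Bb → ⊆xs b (Bb , f<K b)))
  where
  below : ∀ n → ¬ ¬ Finite (λ b → B b × f b < n)
  below zero    ¬f = ¬f ([] , λ _ ())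
  below (suc n) ¬f = below n λ F₁ → noFibre (n , λ F₂ → ¬f (finite-⊎ F₁ F₂ split))
    where
    split : ∀ {b} → B b × f b < suc n → (B b × f b < n) ⊎ (B b × f b ≡ n)
    split (Bb , f<1+n) with m≤n⇒m<n∨m≡n (s≤s⁻¹ f<1+n)
    ... | inj₁ f<n = inj₁ (Bb , f<n)
    ... | inj₂ f≡n = inj₂ (Bb , f≡n)

-- Each of the `m` functions in turn is made constant by passing to an infinite fibre; constancy of
-- the earlier ones is inherited by subsets.
infinite-homogeneous : ∀ (f : ℕ → ℕ → ℕ) K → (∀ i b → f i b < K) → ∀ m {B : Pred ℕ 0ℓ} → ¬ Finite B →
  ¬ ¬ Σ (Pred ℕ 0ℓ) λ C → C ⊆ B × ¬ Finite C × (∀ {i} → i < m → ∀ {x y} → C x → C y → f i x ≡ f i y)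
infinite-homogeneous f K f<K zero    {B} ¬fin none = none (B , id , ¬fin , λ ())
infinite-homogeneous f K f<K (suc m) {B} ¬fin none =
  infinite-homogeneous f K f<K m ¬fin λ (C , C⊆B , ¬finC , homC) →
  infinite-fibre (f m) K (f<K m) ¬finC λ (r , ¬finD) →
  none ((λ b → C b × f m b ≡ r) , (λ (Cb , _) → C⊆B Cb) , ¬finD , homogeneous C homC r)
  where
  homogeneous : ∀ (C : Pred ℕ 0ℓ) → (∀ {i} → i < m → ∀ {x y} → C x → C y → f i x ≡ f i y) → ∀ r {i} → i < suc m →
    ∀ {x y} → C x × f m x ≡ r → C y × f m y ≡ r → f i x ≡ f i y
  homogeneous C homC r i<1+m (Cx , eqx) (Cy , eqy) with m≤n⇒m<n∨m≡n (s≤s⁻¹ i<1+m)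
  ... | inj₁ i<m  = homC i<m Cx Cy
  ... | inj₂ refl = trans eqx (sym eqy)

infinite-unbounded : ∀ {B : Pred ℕ 0ℓ} → ¬ Finite B → ∀ M → ¬ ¬ ∃ λ b → B b × M < b
infinite-unbounded ¬fin M none = ¬fin (upTo (suc M) , λ b Bb →
  ∈-upTo⁺ (s≤s (≮⇒≥ λ M<b → none (b , Bb , M<b))))

-- The lower bound `M` drives the induction, where the later elements must exceed `b₀`; afterwards
-- it pushes products past a threshold.
infinite-chain : ∀ {B : Pred ℕ 0ℓ} → ¬ Finite B → ∀ k M →
  ¬ ¬ Σ (Fin k → ℕ) λ b → (∀ i j → i Fin.< j → b i < b j) × (∀ i → B (b i)) × (∀ i → M < b i)
infinite-chain ¬fin zero    M none = none ((λ ()) , (λ ()) , (λ ()) , (λ ()))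
infinite-chain {B} ¬fin (suc k) M none =
  infinite-unbounded ¬fin M λ (b₀ , Bb₀ , M<b₀) →
  infinite-chain ¬fin k b₀ λ (b , increasing , b∈B , b₀<b) →
  none ((λ { zero → b₀ ; (suc i) → b i }) ,
        (λ { zero (suc j) _ → b₀<b j ; (suc i) (suc j) (s≤s i<j) → increasing i j i<j }) ,
        (λ { zero → Bb₀ ; (suc i) → b∈B i }) ,
        (λ { zero → M<b₀ ; (suc i) → <-trans M<b₀ (b₀<b i) }))

-- Valuations of products of congruent factors

1≤product-tabulate : ∀ {n} (b : Fin n → ℕ) → (∀ i → 1 ≤ b i) → 1 ≤ product (tabulate b)
1≤product-tabulate {zero}  b 1≤b = ≤-refl
1≤product-tabulate {suc n} b 1≤b = 1≤* (1≤b zero) (1≤product-tabulate (b ∘ suc) (1≤b ∘ suc))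

-- The number `n` of factors is kept apart from the modulus `k` so that induction on `n` is
-- possible; the two are identified only in `∣ν-product-tabulate`.
ν-product-tabulate : ∀ p k .{{_ : NonZero k}} r {n} (b : Fin n → ℕ) → (∀ i → 1 ≤ b i) →
  (∀ i → ν p (b i) % k ≡ r) → ∃ λ t → ν p (product (tabulate b)) ≡ n * r + t * k
ν-product-tabulate p k r {zero}  b 1≤b res = 0 , ν-1 p
ν-product-tabulate p k r {suc n} b 1≤b res with ν-product-tabulate p k r (b ∘ suc) (1≤b ∘ suc) (res ∘ suc)
... | t , eq = u + t , (begin
  ν p (b zero * product (tabulate (b ∘ suc)))
    ≡⟨ ν-* p (b zero) _ (1≤b zero) (1≤product-tabulate (b ∘ suc) (1≤b ∘ suc)) ⟩
  ν p (b zero) + ν p (product (tabulate (b ∘ suc)))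
    ≡⟨ cong₂ _+_ (trans (m≡m%n+[m/n]*n (ν p (b zero)) k) (cong (_+ u * k) (res zero))) eq ⟩
  (r + u * k) + (n * r + t * k)
    ≡⟨ +-CS.interchange r (u * k) (n * r) (t * k) ⟩
  (r + n * r) + (u * k + t * k)
    ≡⟨ cong (λ x → (r + n * r) + x) (*-distribʳ-+ k u t) ⟨
  suc n * r + (u + t) * k ∎)
  where
  open ≡-Reasoning
  u = ν p (b zero) ℕ./ k

∣ν-product-tabulate : ∀ p {k} r (b : Fin (suc k) → ℕ) → (∀ i → 1 ≤ b i) →
  (∀ i → ν p (b i) % suc k ≡ r) → suc k ∣ ν p (product (tabulate b))
∣ν-product-tabulate p {k} r b 1≤b res with ν-product-tabulate p (suc k) r b 1≤b res
... | t , eq = subst (suc k ∣_) (sym eq) (∣m∣n⇒∣m+n (m∣m*n r) (n∣m*n t))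

∣ν-power-* : ∀ p k {α m} → 1 ≤ α → 1 ≤ m → k ∣ ν p m → k ∣ ν p (α ^ k * m)
∣ν-power-* p k {α} {m} 1≤α 1≤m k∣ = subst (k ∣_)
  (sym (trans (ν-* p (α ^ k) m (1≤^ k 1≤α) 1≤m) (cong (_+ ν p m) (ν-^ p α k 1≤α))))
  (∣m∣n⇒∣m+n (m∣m*n (ν p α)) k∣)

-- Multiplying by α^k turns the coset of t = α / β times the (k+1)-st powers into honest (k+1)-st
-- powers, so that only the natural number β α^k has to be remembered about t.
complete-power : ∀ α β k {m n} → α * m ≡ β * n → n * (β * α ^ k) ≡ α ^ suc k * m
complete-power α β k {m} {n} eq = begin
  n * (β * α ^ k)     ≡⟨ *-CS.x∙yz≈yx∙z n β _ ⟩
  β * n * α ^ k       ≡⟨ cong (_* α ^ k) eq ⟨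
  α * m * α ^ k       ≡⟨ *-CS.xy∙z≈xz∙y α m _ ⟩
  α * α ^ k * m       ∎
  where
  open ≡-Reasoning

clear-denominator : ∀ a b m n → (+ suc a / suc b) ℚ.* ℕ→ℚ m ≡ ℕ→ℚ n → suc a * m ≡ suc b * n
clear-denominator a b m n eq = trans (sym (*-identityʳ _))
  (trans (ℤ.+-injective (trans (ℤ.pos-* (suc a * m) 1) (trans (cong (ℤ._* + 1) (ℤ.pos-* (suc a) m))
    (trans (ℚᵘ.drop-*≡* equiv) (sym (ℤ.pos-* n (suc b * 1)))))))
  (trans (cong (n *_) (*-identityʳ (suc b))) (*-comm n (suc b))))
  where
  equiv : mkℚᵘ (+ suc a) b ℚᵘ.* mkℚᵘ (+ m) 0 ℚᵘ.≃ mkℚᵘ (+ n) 0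
  equiv = ℚᵘ.≃-trans
    (ℚᵘ.*-cong (ℚᵘ.≃-sym (ℚ.toℚᵘ-fromℚᵘ (mkℚᵘ (+ suc a) b))) (ℚᵘ.≃-sym (ℚ.toℚᵘ-fromℚᵘ (mkℚᵘ (+ m) 0))))
    (ℚᵘ.≃-trans (ℚᵘ.≃-sym (ℚ.toℚᵘ-homo-* (+ suc a / suc b) (ℕ→ℚ m)))
    (ℚᵘ.≃-trans (ℚ.toℚᵘ-cong eq) (ℚ.toℚᵘ-fromℚᵘ (mkℚᵘ (+ n) 0))))

∈⇒≤sum : ∀ {x xs} → x ∈ xs → x ≤ sumList xs
∈⇒≤sum {x} {_ ∷ xs} (here refl) = m≤m+n x (sumList xs)
∈⇒≤sum {xs = y ∷ _} (there x∈)  = ≤-trans (∈⇒≤sum x∈) (m≤n+m _ y)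

-- Construction of the set

module Construction {q : ℕ → ℕ} (Q : DistinctPrimes q) (surj : ∀ {p} → Prime p → ∃ λ i → p ≡ q i) (s : ℕ) where

  -- Decoding suc j by its exponents at q 0 and q 1 makes (shift j , exponent j) run through all
  -- pairs (w , k) with w ≥ 1 and k ≥ 2.
  shift exponent : ℕ → ℕ
  shift    j = suc (ν (q 0) (suc j))
  exponent j = 2 + ν (q 1) (suc j)

  encode : ∀ {w} k → 1 ≤ w → ∃ λ j → shift j ≡ w × exponent j ≡ 2 + k
  -- The number with exponents `w` and `k` is positive, hence of the form `suc j`, and its
  -- valuations return the two exponents.
  encode {suc w} k _ with eval q (w ∷ k ∷ []) | 1≤eval Q (w ∷ k ∷ []) | ν-eval Q (w ∷ k ∷ [])
  ... | suc j | _ | veq = j , cong suc (veq 0) , cong (λ t → 2 + t) (veq 1)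

  -- A common multiple of `exponent 0`, ..., `exponent N`, so that the exponent range in `Φ N`
  -- splits into full periods for every class `j ≤ N`.
  side : ℕ → ℕ
  side zero    = exponent 0
  side (suc N) = exponent (suc N) * side N

  exponent∣side : ∀ {j N} → j ≤ N → exponent j ∣ side N
  exponent∣side {zero}  {zero}  _   = divides 1 (sym (*-identityˡ _))
  exponent∣side {j}     {suc N} j≤N with m≤n⇒m<n∨m≡n j≤N
  ... | inj₁ j<N  = ∣n⇒∣m*n (exponent (suc N)) (exponent∣side (s≤s⁻¹ j<N))
  ... | inj₂ refl = m∣m*n (side N)

  N<side : ∀ N → N < side N
  N<side zero    = s≤s z≤n
  N<side (suc N) = begin
    suc (suc N)                  ≤⟨ +-mono-≤ (≤-trans (s≤s z≤n) (N<side N)) (N<side N) ⟩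
    side N + side N              ≡⟨ cong (λ t → side N + t) (+-identityʳ (side N)) ⟨
    2 * side N                   ≤⟨ *-monoˡ-≤ (side N) {2} {exponent (suc N)} (s≤s (s≤s z≤n)) ⟩
    exponent (suc N) * side N    ∎
    where open ≤-Reasoning

  -- The dimension `s + suc N` makes room for the `s + suc j` valuations tested by each class
  -- `j ≤ N`.
  Φ : ℕ → List ℕ
  Φ N = grid Q (side N) (s + suc N)

  Φ-isFolner : IsFolner Φ
  Φ-isFolner = grid-isFolner Q surj side (λ N → s + suc N) N<side
    (λ N → ≤-trans (n≤1+n N) (m≤n+m (suc N) s))

  -- Bounds all elements of Φ 0, …, Φ (j − 1), so that the j-th class removes nothing from them.
  threshold : ℕ → ℕ
  threshold zero    = 0
  threshold (suc j) = suc (sumList (Φ j) + threshold j)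

  j≤threshold : ∀ j → j ≤ threshold j
  j≤threshold zero    = z≤n
  j≤threshold (suc j) = s≤s (≤-trans (j≤threshold j) (m≤n+m _ (sumList (Φ j))))

  Φ≤threshold : ∀ {N j x} → N < j → x ∈ Φ N → x ≤ threshold j
  Φ≤threshold {N} {suc j} N<1+j x∈ with m≤n⇒m<n∨m≡n (s≤s⁻¹ N<1+j)
  ... | inj₁ N<j  = ≤-trans (Φ≤threshold N<j x∈) (≤-trans (m≤n+m _ (sumList (Φ j))) (n≤1+n _))
  ... | inj₂ refl = ≤-trans (∈⇒≤sum x∈) (≤-trans (m≤m+n _ (threshold j)) (n≤1+n _))

  -- As `exponent j ≥ 2`, testing `s + suc j` primes cuts the proportion in `Φ N`, for `j ≤ N`, to
  -- at most `2 ^ -(s + j + 1)`, and these bounds are summable over `j` with total `2 ^ -s`.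
  PowerClass : ℕ → Pred ℕ 0ℓ
  PowerClass j n = DividesFirst (exponent j) (λ i → ν (q i) (n * shift j)) (s + suc j)

  powerClass? : ∀ j → Decidable (PowerClass j)
  powerClass? j n = dividesFirst? (exponent j) (λ i → ν (q i) (n * shift j)) (s + suc j)

  -- The redundant bound j < n (see j≤threshold) makes the search for j finite.
  Excluded : Pred ℕ 0ℓ
  Excluded n = ∃ λ j → j < n × threshold j < n × PowerClass j n

  A : Pred ℕ 0ℓ
  A n = ¬ Excluded n

  A? : Decidable A
  A? n = ¬? (anyUpTo? (λ j → (threshold j <? n) ×-dec powerClass? j n) n)

  -- On `eval q es` the tested valuations are the coordinates of `es` plus constants coming from
  -- `shift j`, so `count-dividesFirst` applies once `side N` is written as a multiple of
  -- `exponent j`.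
  count-powerClass : ∀ {j N} → j ≤ N → 2 ^ (s + suc j) * count (powerClass? j) (Φ N) ≤ length (Φ N)
  count-powerClass {j} {N} j≤N with exponent∣side j≤N
  ... | divides h side≡ rewrite length-grid Q (side N) (s + suc N) | side≡ = begin
    2 ^ m * count (powerClass? j) (grid Q (h * k) d)
      ≤⟨ *-mono-≤ (^-monoˡ-≤ m {2} (s≤s (s≤s z≤n)))
           (count-map-mono (powerClass? j) Div? (eval q) (box (h * k) d) (λ {es} _ → toCoord es)) ⟩
    k ^ m * count Div? (box (h * k) d)
      ≤⟨ count-dividesFirst k h m c (+-monoʳ-≤ s (s≤s j≤N)) ⟩
    (h * k) ^ d ∎
    where
    open ≤-Reasoning
    k = exponent j
    m = s + suc j
    d = s + suc N
    c : ℕ → ℕ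
    c i = ν (q i) (shift j)
    Div? : Decidable {A = Vec ℕ d} (λ es → DividesFirst k (λ i → coord es i + c i) m)
    Div? es = dividesFirst? k (λ i → coord es i + c i) m
    toCoord : ∀ es → PowerClass j (eval q es) → DividesFirst k (λ i → coord es i + c i) m
    toCoord es div {i} i<m = subst (k ∣_)
      (trans (ν-* (q i) (eval q es) (shift j) (1≤eval Q es) (s≤s z≤n)) (cong (_+ c i) (ν-eval Q es i)))
      (div i<m)

  count-excluded : ∀ N → 2 ^ s * count (λ n → ¬? (A? n)) (Φ N) ≤ length (Φ N)
  count-excluded N = begin
    2 ^ s * count (λ n → ¬? (A? n)) (Φ N)
      ≤⟨ *-monoʳ-≤ (2 ^ s) (≤-trans
           (count-mono (λ n → ¬? (A? n)) (λ n → anyUpTo? (λ j → powerClass? j n) (suc N)) (Φ N) early)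
           (count-∃< powerClass? (suc N) (Φ N))) ⟩
    2 ^ s * sumList (applyUpTo (λ j → count (powerClass? j) (Φ N)) (suc N))
      ≡⟨ sum-scale (2 ^ s) (λ j → count (powerClass? j) (Φ N)) (suc N) ⟨
    sumList (applyUpTo (λ j → 2 ^ s * count (powerClass? j) (Φ N)) (suc N))
      ≤⟨ geometric-sum (suc N) _ (λ {j} j<1+N → ≤-trans (≤-reflexive (regroup j)) (count-powerClass (s≤s⁻¹ j<1+N))) ⟩
    length (Φ N) ∎
    where
    open ≤-Reasoning
    regroup : ∀ j → 2 ^ suc j * (2 ^ s * count (powerClass? j) (Φ N)) ≡ 2 ^ (s + suc j) * count (powerClass? j) (Φ N)
    regroup j = trans (sym (*-assoc (2 ^ suc j) (2 ^ s) _)) (cong (_* count (powerClass? j) (Φ N))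
      (trans (*-comm (2 ^ suc j) (2 ^ s)) (sym (^-distribˡ-+-* 2 s (suc j)))))
    early : ∀ {n} → n ∈ Φ N → ¬ A n → ∃ λ j → j < suc N × PowerClass j n
    early {n} n∈ ¬An with anyUpTo? (λ j → (threshold j <? n) ×-dec powerClass? j n) n
    ... | no ¬ex = contradiction ¬ex ¬An
    -- A class with `N < j` cannot exclude `n`, since its threshold bounds every element of `Φ N`.
    ... | yes (j , _ , thr<n , cls) = j , s≤s (≮⇒≥ λ N<j → <⇒≱ thr<n (Φ≤threshold N<j n∈)) , cls

  -- An infinite `B` would have an infinite subset whose valuations at the tested primes agree
  -- modulo `suc k`. The product of `suc k` large elements of it, scaled by `α / β`, then lies in
  -- class `j` beyond its threshold and is excluded from `A`.
  scaledProducts⊆A⇒finite : ∀ {α β k j} {B : Pred ℕ 0ℓ} → 1 ≤ α → 1 ≤ β →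
    shift j ≡ β * α ^ k → exponent j ≡ suc k → (∀ b → B b → 1 ≤ b) →
    (∀ (c : Fin (suc k) → ℕ) → (∀ i i′ → i Fin.< i′ → c i < c i′) → (∀ i → B (c i)) →
      ∃ λ n → α * product (tabulate c) ≡ β * n × A n) →
    ¬ ¬ Finite B
  scaledProducts⊆A⇒finite {α} {β} {k} {j} {B} 1≤α 1≤β shift≡ exponent≡ 1≤B ⊆A ¬fin =
    infinite-homogeneous (λ i x → ν (q i) x % suc k) (suc k) (λ i x → m%n<n (ν (q i) x) (suc k)) (s + suc j) ¬fin
      λ (C , C⊆B , ¬finC , homogeneous) →
    -- The factor `β` compensates the division in `n = α P / β`: already `c zero > β * threshold j`
    -- yields `n > threshold j`.
    infinite-chain ¬finC (suc k) (β * threshold j) λ (c , increasing , c∈C , large) →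
    hit c (λ i → 1≤B (c i) (C⊆B (c∈C i))) (large zero)
      (λ i<m x → homogeneous i<m (c∈C x) (c∈C zero)) (⊆A c increasing (λ i → C⊆B (c∈C i)))
    where
    hit : ∀ (c : Fin (suc k) → ℕ) → (∀ i → 1 ≤ c i) → β * threshold j < c zero →
      (∀ {i} → i < s + suc j → ∀ x → ν (q i) (c x) % suc k ≡ ν (q i) (c zero) % suc k) →
      (∃ λ n → α * product (tabulate c) ≡ β * n × A n) → ⊥
    hit c 1≤c large homogeneous (n , αP≡βn , An) = An (j , ≤-<-trans (j≤threshold j) thr<n , thr<n , inClass)
      where
      P = product (tabulate c)
      thr<n : threshold j < n
      thr<n = *-cancelˡ-< β (threshold j) n (begin-strict
        β * threshold j    <⟨ large ⟩
        c zero             ≤⟨ m≤m*n (c zero) _ {{>-nonZero (1≤product-tabulate (c ∘ suc) (1≤c ∘ suc))}} ⟩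
        P                  ≤⟨ m≤n*m P α {{>-nonZero 1≤α}} ⟩
        α * P              ≡⟨ αP≡βn ⟩
        β * n              ∎)
        where open ≤-Reasoning
      inClass : PowerClass j n
      -- By `complete-power`, `n * shift j` equals `α ^ suc k * P`, and both factors have valuation
      -- divisible by `suc k`.
      inClass {i} i<m = subst₂ (λ K x → K ∣ ν (q i) x) (sym exponent≡)
        (sym (trans (cong (n *_) shift≡) (complete-power α β k αP≡βn)))
        (∣ν-power-* (q i) (suc k) 1≤α (1≤product-tabulate c 1≤c)
          (∣ν-product-tabulate (q i) (ν (q i) (c zero) % suc k) c 1≤c (homogeneous i<m)))

theorem1p4 : (ε : ℚ) → 0ℚ ℚ.< ε →
    Σ (Pred ℕ 0ℓ) λ A → Σ (Decidable A) λ A? →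
    BanachDensityExceeds A? (1ℚ ℚ.- ε) ×
    ((B : Pred ℕ 0ℓ) → (∀ b → B b → 1 ≤ b) →
    (t : ℚ) → 0ℚ ℚ.< t → (k : ℕ) → 2 ≤ k →
    ScaledProdSetSubset t B k A → ¬ ¬ Finite B)
theorem1p4 ε 0<ε with positiveFraction 0<ε | primeEnumeration
... | a , e , refl | q , Q , surj = A , A? , (Φ , Φ-isFolner , r , one-minus-< a e , dense) , finite
  where
  -- With `suc e` the denominator of `ε`, the choice `s = e + 2` gives `2 ^ -s < 1 / (e + 2) < ε`.
  open Construction Q surj (suc (suc e))
  r = + suc e / suc (suc e)
  dense : ∀ M → ∃ λ N → M ≤ N × r ℚ.< frac (interCard A? (Φ N)) (length (Φ N))
  -- The density bound holds on every `Φ N`, so `N = M` will do.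
  dense M = M , ≤-refl , density-from-bad e (count-complement A? (Φ M)) (few (suc (suc e)) (count (λ n → ¬? (A? n)) (Φ M))
    (count-excluded M) (1≤length-grid Q (suc (suc e) + suc M) (≤-trans (s≤s z≤n) (N<side M))))
    where
    few : ∀ D {T} bad → 2 ^ D * bad ≤ T → 1 ≤ T → D * bad < T
    -- Strictness comes from `D < 2 ^ D` only if `bad` is positive; for `bad = 0` it comes from
    -- `Φ M` being nonempty.
    few D {T} zero      _     1≤T = subst (_< T) (sym (*-zeroʳ D)) 1≤T
    few D (suc bad) bound _   = <-≤-trans (*-monoˡ-< (suc bad) (n<2^n D)) bound
  finite : ∀ B → (∀ b → B b → 1 ≤ b) → ∀ t → 0ℚ ℚ.< t → ∀ k → 2 ≤ k → ScaledProdSetSubset t B k A → ¬ ¬ Finite B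
  finite B 1≤B t 0<t (suc zero) (s≤s ()) ⊆A
  finite B 1≤B t 0<t (suc (suc k)) _ ⊆A with positiveFraction 0<t
  ... | c , d , refl with encode k (1≤* {suc d} (s≤s z≤n) (1≤^ (suc k) (s≤s {n = c} z≤n)))
  ...   | j , shift≡ , exponent≡ = scaledProducts⊆A⇒finite {α = suc c} {β = suc d} (s≤s z≤n) (s≤s z≤n) shift≡ exponent≡ 1≤B
    λ b increasing b∈B → let n , tP≡n , An = ⊆A b increasing b∈B
      in n , clear-denominator c d _ n tP≡n , An
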